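{- Let $F$ be a simple graph with $p=v(F)$ and $q=e(F)>1$, and let $B\subset B(\binom p2,F)$. If $f:\mathbb{N}\to\mathbb{N}$ is a nondecreasing function such that $\mathrm{gex}(B,n)<n\cdot f(n)$ for every $n\in\mathbb{N}$, then $$\mathrm{ex}_e(F,n)<q\cdot\mathrm{gex}(F,n)\cdot\mathrm{ex}_e(F,2f(n)+1)$$ for every $n\in\mathbb{N}$ with $n\ge 3$.
   Context: A hypergraph $H=(E_i: i\in I)$ is a finite list of finite nonempty subsets of $\mathbb{N}$ (edges; repetitions allowed); it is simple if its edges are pairwise distinct; a graph is a hypergraph all of whose edges have 2 elements. $v(H)=|\bigcup_i E_i|$, $e(H)=|I|$. $H$ contains $H'=(E'_i:i\in I')$, written $H\succ H'$, if there exist an increasing injection $\phi:\bigcup H'\to\bigcup H$ and an injection $f:I'\to I$ such that $v\in E'_i$ implies $\phi(v)\in E_{f(i)}$; an $H'$-copy in $H$ is the corresponding sub-configuration. $\mathrm{ex}_e(F,n)=\max\{e(H): H\not\succ F,\ H\text{ simple hypergraph},\ v(H)\le n\}$. For a family $R$ of simple graphs, $\mathrm{gex}(R,n)=\max\{e(G): G \text{ simple graph},\ v(G)\le n,\ G\not\succ G' \text{ for all } G'\in R\}$, and $\mathrm{gex}(G,n)=\mathrm{gex}(\{G\},n)$. For $k\in\mathbb{N}$, a simple graph $G'$ is a $k$-blow-up of a simple graph $G$ if for every edge colouring $\chi:G'\to\mathbb{N}$ using each colour at most $k$ times there is a $G$-copy in $G'$ on whose edges $\chi$ is injective; $B(k,G)$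 is the set of all $k$-blow-ups of $G$. -}

module Defs where

open import Data.Nat using (ℕ; _<_; _≤_; _≟_)
open import Data.Nat.Combinatorics using (_C_)
open import Data.Fin using (Fin)
open import Data.List using (List; []; length; filter; concat; map; allFin; deduplicate)
open import Data.List.Membership.Propositional using (_∈_)
open import Data.List.Relation.Unary.Linked using (Linked)
open import Data.Product using (Σ; _×_; ∃)
open import Function using (_∘_)
open import Function.Definitions using (Injective)
open import Relation.Binary.PropositionalEquality using (_≡_; _≢_)
open import Relation.Nullary using (¬_)

-- A hypergraph: a finite list (E_i : i ∈ Fin e) of finite nonempty subsets
-- of ℕ.  A finite subset of ℕ is represented canonically by its strictly
-- increasing list of elements.  Repetitions of edges are allowed.
record Hypergraph : Set where
  field
    e        : ℕ
    edge     : Fin e → List ℕ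
    sorted   : ∀ i → Linked _<_ (edge i)
    nonempty : ∀ i → edge i ≢ []
open Hypergraph public

eH : Hypergraph → ℕ
eH H = e H

_∈V_ : ℕ → Hypergraph → Set
v ∈V H = ∃ λ i → v ∈ edge H i

vH : Hypergraph → ℕ
vH H = length (deduplicate _≟_ (concat (map (edge H) (allFin (e H)))))

-- simple: edges pairwise distinct (canonical representation, so ≡ is set equality)
IsSimple : Hypergraph → Set
IsSimple H = Injective _≡_ _≡_ (edge H)

IsGraph : Hypergraph → Set
IsGraph H = ∀ i → length (edge H i) ≡ 2

IsSimpleGraph : Hypergraph → Set
IsSimpleGraph H = IsSimple H × IsGraph H

-- A witness that H contains H' (H ≻ H'): an increasing injection φ on ⋃H'
-- and an injection f of edge indices with v ∈ E'_i ⇒ φ v ∈ E_{f i}.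
-- (φ maps ⋃H' into ⋃H automatically by the inclusion condition.)
record Embedding (H′ H : Hypergraph) : Set where
  field
    φ     : ℕ → ℕ
    φ-inc : ∀ u w → u ∈V H′ → w ∈V H′ → u < w → φ u < φ w
    f     : Fin (e H′) → Fin (e H)
    f-inj : Injective _≡_ _≡_ f
    incl  : ∀ i v → v ∈ edge H′ i → φ v ∈ edge H (f i)
open Embedding public

_≻_ : Hypergraph → Hypergraph → Set
H ≻ H′ = Embedding H′ H

colourCount : (H : Hypergraph) → (Fin (e H) → ℕ) → ℕ → ℕ
colourCount H χ c = length (filter (λ i → χ i ≟ c) (allFin (e H)))

IsBlowUp : ℕ → Hypergraph → Hypergraph → Set
IsBlowUp k G G′ =
  IsSimpleGraph G′ ×
  ((χ : Fin (e G′) → ℕ) → (∀ c → colourCount G′ χ c ≤ k) →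
     Σ (Embedding G G′) λ emb → Injective _≡_ _≡_ (χ ∘ f emb))

_∈B[_,_] : Hypergraph → ℕ → Hypergraph → Set
G′ ∈B[ k , G ] = IsBlowUp k G G′

GexAdmissible : (Hypergraph → Set) → ℕ → Hypergraph → Set
GexAdmissible R n G = IsSimpleGraph G × vH G ≤ n × (∀ G′ → R G′ → ¬ (G ≻ G′))

Singleton : Hypergraph → Hypergraph → Set
Singleton F G′ = G′ ≡ F

ExAdmissible : Hypergraph → ℕ → Hypergraph → Set
ExAdmissible F n H = IsSimple H × vH H ≤ n × ¬ (H ≻ F)

IsMaxEdges : (Hypergraph → Set) → ℕ → Set
IsMaxEdges P m = (Σ Hypergraph λ H → P H × eH H ≡ m) × (∀ H → P H → eH H ≤ m)

IsGex : (Hypergraph → Set) → ℕ → ℕ → Set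
IsGex R n m = IsMaxEdges (GexAdmissible R n) m

IsExe : Hypergraph → ℕ → ℕ → Set
IsExe F n m = IsMaxEdges (ExAdmissible F n) m

Nondecreasing : (ℕ → ℕ) → Set
Nondecreasing f = ∀ m n → m ≤ n → f m ≤ f n

-- Call an edge of an F-free simple H small if it has at most p = v(F) elements,
-- and large otherwise.  Choosing greedily a new pair inside each large edge never
-- gets stuck, since an edge with no new pair would give a copy of F among the pairs
-- already chosen; these pairs form an F-free graph, so there are at most
-- g = gex(F,n) large edges.  The graph of all pairs inside small edges contains no
-- member of B, hence has average degree below 2f(n), and so has a vertex v of degree
-- below 2f(n); the small edges through v live on v and its neighbours, so there are
-- at most x = ex_e(F,2f(n)+1) of them.  Deleting v and iterating bounds the small
-- edges by nx.  The stars centred at the first and at the last vertex do not both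
-- contain F, so g ≥ n-1; singletons give x ≥ 3; thus nx + g < 2gx.

module Submission where

open import Defs
open import Data.Fin as Fin using (Fin; toℕ; zero; suc)
open import Data.Fin.Properties using (toℕ-injective; toℕ-fromℕ<)
open import Data.List
  using (List; []; _∷_; [_]; _++_; length; lookup; map; filter; concat; concatMap; tabulate; allFin; deduplicate; upTo)
open import Data.List.Membership.Propositional using (_∈_; find; lose)
open import Data.List.Membership.Propositional.Properties
  using (∈-map⁺; ∈-map⁻; ∈-++⁺ˡ; ∈-++⁺ʳ; ∈-++⁻; ∈-∃++; ∈-concat⁺′; ∈-concat⁻′; ∈-concatMap⁺; ∈-concatMap⁻;
         ∈-filter⁺; ∈-filter⁻; ∈-deduplicate⁺; ∈-deduplicate⁻; ∈-lookup; ∈-allFin; ∈-tabulate⁻; ∈-upTo⁺; ∈-upTo⁻; ∈-length)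
open import Data.List.Properties
  using (filter-notAll; length-map; length-++; ≡-dec; ∷-injectiveˡ; ∷-injectiveʳ; length-tabulate; length-upTo)
open import Data.List.Relation.Binary.Pointwise using (Pointwise; []; _∷_; Pointwise-length)
open import Data.List.Relation.Binary.Subset.Propositional using (_⊆_)
open import Data.List.Relation.Unary.All as All using (All; []; _∷_)
open import Data.List.Relation.Unary.All.Properties using (¬Any⇒All¬)
open import Data.List.Relation.Unary.AllPairs using ([]; _∷_)
open import Data.List.Relation.Unary.Any using (Any; here; there; any?; index)
open import Data.List.Relation.Unary.Any.Properties using (lookup-index)
open import Data.List.Relation.Unary.Linked using (Linked; []; [-]; _∷_)
open import Data.List.Relation.Unary.Linked.Properties using (Linked⇒AllPairs)
open import Data.List.Relation.Unary.Unique.Propositional using (Unique)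
open import Data.List.Relation.Unary.Unique.Propositional.Properties as Uniq
  using (tabulate⁺; allFin⁺; upTo⁺; filter⁺)
open import Data.Nat using (ℕ; zero; suc; _<_; _≤_; _*_; _+_; _≟_; _<?_; _≤?_; s≤s; z≤n; z<s; s<s; s≤s⁻¹)
open import Data.Nat.Combinatorics using (_C_; nC1≡n; nCk+nC[k+1]≡[n+1]C[k+1])
open import Data.Nat.ListAction using (sum)
open import Data.Nat.Properties
open import Data.Nat.Tactic.RingSolver using (solve-∀)
open import Data.Product using (_×_; _,_; ∃; ∃₂; proj₁; proj₂)
open import Data.Sum using (inj₁; inj₂)
open import Function using (_∘_)
open import Function.Definitions using (Injective)
open import Relation.Binary.Definitions using (DecidableEquality; tri<; tri≈; tri>)
open import Relation.Binary.PropositionalEquality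
  using (_≡_; _≢_; refl; sym; trans; cong; cong₂; subst; ≢-sym; module ≡-Reasoning)
open import Relation.Nullary using (¬_; Dec; yes; no; contradiction; ¬?)
open import Relation.Nullary.Decidable using (decidable-stable)
open import Relation.Unary using (Decidable)

open import Data.List.Relation.Unary.Unique.DecPropositional.Properties _≟_
  using (deduplicate-!)

private
  variable
    A A′ : Set

_≟L_ : DecidableEquality (List ℕ)
_≟L_ = ≡-dec _≟_

open import Data.List.Relation.Unary.Unique.DecPropositional.Properties _≟L_
  using () renaming (deduplicate-! to deduplicateL-!)
open import Data.List.Membership.DecPropositional _≟_ using (_∈?_)
open import Data.List.Membership.DecPropositional _≟L_
  using () renaming (_∈?_ to _∈L?_)

-- Counting in finite lists

-- Cut one occurrence of the head of `xs` out of `ys`. Since `xs` has no repetitions, its tail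
-- avoids the head and still lies in what remains.
unique-⊆-length : {xs ys : List A} → Unique xs → xs ⊆ ys → length xs ≤ length ys
unique-⊆-length {xs = []} _ _ = z≤n
unique-⊆-length {xs = x ∷ xs} (x∉ ∷ u) xs⊆ys with ∈-∃++ (xs⊆ys (here refl))
... | as , bs , refl = begin
  suc (length xs)               ≤⟨ s≤s (unique-⊆-length u sub) ⟩
  suc (length (as ++ bs))       ≡⟨ cong suc (length-++ as) ⟩
  suc (length as + length bs)   ≡⟨ +-suc (length as) (length bs) ⟨
  length as + length (x ∷ bs)   ≡⟨ length-++ as ⟨
  length (as ++ x ∷ bs)         ∎
  where
  open ≤-Reasoning
  sub : xs ⊆ as ++ bs
  sub z∈ with ∈-++⁻ as (xs⊆ys (there z∈))
  ... | inj₁ z∈as         = ∈-++⁺ˡ z∈as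
  ... | inj₂ (here refl)  = contradiction refl (All.lookup x∉ z∈)
  ... | inj₂ (there z∈bs) = ∈-++⁺ʳ as z∈bs

lookup-injective : {xs : List A} → Unique xs → ∀ {i j} → lookup xs i ≡ lookup xs j → i ≡ j
lookup-injective (_ ∷ _)  {zero}  {zero}  _  = refl
lookup-injective (x∉ ∷ _) {zero}  {suc j} eq = contradiction eq (All.lookup x∉ (∈-lookup j))
lookup-injective (x∉ ∷ _) {suc i} {zero}  eq = contradiction (sym eq) (All.lookup x∉ (∈-lookup i))
lookup-injective (_ ∷ u)  {suc i} {suc j} eq = cong suc (lookup-injective u eq)

length-filter-¬ : {P : A → Set} (P? : Decidable P) (xs : List A) →
  length xs ≡ length (filter P? xs) + length (filter (¬? ∘ P?) xs)
length-filter-¬ P? [] = refl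
length-filter-¬ P? (x ∷ xs) with P? x
... | yes _ = cong suc (length-filter-¬ P? xs)
... | no _  = trans (cong suc (length-filter-¬ P? xs))
                (sym (+-suc (length (filter P? xs)) (length (filter (¬? ∘ P?) xs))))

-- Both sides count the related pairs, by rows and by columns; `split` peels off the row of `x`.
double-count : {R : A → A′ → Set} (R? : ∀ a b → Dec (R a b)) (xs : List A) (ys : List A′) →
  sum (map (λ a → length (filter (R? a) ys)) xs) ≡
  sum (map (λ b → length (filter (λ a → R? a b) xs)) ys)
double-count R? [] ys = sym (zeros ys)
  where
  zeros : (ys : List A′) → sum (map (λ _ → 0) ys) ≡ 0
  zeros []       = refl
  zeros (_ ∷ ys) = zeros ys
double-count {A = A} {A′ = A′} R? (x ∷ xs) ys =
  trans (cong (length (filter (R? x) ys) +_) (double-count R? xs ys)) (sym (split ys))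
  where
  col : A′ → ℕ
  col b = length (filter (λ a → R? a b) xs)
  swap : ∀ a b c → a + (b + c) ≡ b + (a + c)
  swap = solve-∀
  split : ∀ ys → sum (map (λ b → length (filter (λ a → R? a b) (x ∷ xs))) ys) ≡
                 length (filter (R? x) ys) + sum (map col ys)
  split [] = refl
  split (y ∷ ys) with R? x y
  ... | yes _ = cong suc (trans (cong (col y +_) (split ys)) (swap (col y) (length (filter (R? x) ys)) _))
  ... | no _  = trans (cong (col y +_) (split ys)) (swap (col y) (length (filter (R? x) ys)) _)

sum-map-≤ : (h : A → ℕ) (c : ℕ) (xs : List A) → (∀ {a} → a ∈ xs → h a ≤ c) →
  sum (map h xs) ≤ length xs * c
sum-map-≤ h c []       _ = z≤n
sum-map-≤ h c (x ∷ xs) b = +-mono-≤ (b (here refl)) (sum-map-≤ h c xs (b ∘ there))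

sum-map-≥ : (h : A → ℕ) (c : ℕ) (xs : List A) → All (λ a → c ≤ h a) xs →
  length xs * c ≤ sum (map h xs)
sum-map-≥ h c []       _        = z≤n
sum-map-≥ h c (x ∷ xs) (b ∷ bs) = +-mono-≤ b (sum-map-≥ h c xs bs)

-- Two-element subsets

Sorted : List ℕ → Set
Sorted = Linked _<_

sorted⇒head< : ∀ {x xs} → Sorted (x ∷ xs) → All (x <_) xs
sorted⇒head< s with Linked⇒AllPairs <-trans s
... | h ∷ _ = h

sorted-tail : ∀ {x xs} → Sorted (x ∷ xs) → Sorted xs
sorted-tail [-]     = []
sorted-tail (_ ∷ s) = s

-- On a sorted list every entry is increasing, so each 2-element subset appears in the canonical
-- form of an edge.
pairs : List ℕ → List (List ℕ)
pairs []       = []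
pairs (x ∷ xs) = map (λ y → x ∷ y ∷ []) xs ++ pairs xs

length-pairs : ∀ E → length (pairs E) ≡ length E C 2
length-pairs []       = refl
length-pairs (x ∷ xs) = begin
  length (map (λ y → x ∷ y ∷ []) xs ++ pairs xs)  ≡⟨ length-++ (map (λ y → x ∷ y ∷ []) xs) ⟩
  length (map (λ y → x ∷ y ∷ []) xs) + length (pairs xs)
    ≡⟨ cong₂ _+_ (trans (length-map _ xs) (sym (nC1≡n (length xs)))) (length-pairs xs) ⟩
  length xs C 1 + length xs C 2                   ≡⟨ nCk+nC[k+1]≡[n+1]C[k+1] (length xs) 1 ⟩
  suc (length xs) C 2                             ∎
  where open ≡-Reasoning

C2-mono : ∀ {m n} → m ≤ n → m C 2 ≤ n C 2
C2-mono {n = n} z≤n = z≤n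
C2-mono {suc m} {suc n} (s≤s m≤n) = begin
  suc m C 2      ≡⟨ nCk+nC[k+1]≡[n+1]C[k+1] m 1 ⟨
  m C 1 + m C 2  ≤⟨ +-mono-≤ (≤-trans (≤-reflexive (nC1≡n m)) (≤-trans m≤n (≤-reflexive (sym (nC1≡n n))))) (C2-mono m≤n) ⟩
  n C 1 + n C 2  ≡⟨ nCk+nC[k+1]≡[n+1]C[k+1] n 1 ⟩
  suc n C 2      ∎
  where open ≤-Reasoning

∈-pairs⁻ : ∀ E {g} → Sorted E → g ∈ pairs E → ∃₂ λ a b → g ≡ a ∷ b ∷ [] × a < b × a ∈ E × b ∈ E
∈-pairs⁻ (x ∷ xs) s g∈ with ∈-++⁻ (map (λ y → x ∷ y ∷ []) xs) g∈
... | inj₂ g∈′ with ∈-pairs⁻ xs (sorted-tail s) g∈′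
...   | a , b , eq , a<b , a∈ , b∈ = a , b , eq , a<b , there a∈ , there b∈
∈-pairs⁻ (x ∷ xs) s g∈ | inj₁ g∈′ with ∈-map⁻ _ g∈′
...   | y , y∈ , refl = x , y , refl , All.lookup (sorted⇒head< s) y∈ , here refl , there y∈

∈-pairs⁺ : ∀ {E a b} → Sorted E → a < b → a ∈ E → b ∈ E → (a ∷ b ∷ []) ∈ pairs E
∈-pairs⁺ s a<b (here refl) (here refl) = contradiction a<b (<-irrefl refl)
∈-pairs⁺ s a<b (here refl) (there b∈)  = ∈-++⁺ˡ (∈-map⁺ _ b∈)
∈-pairs⁺ s a<b (there a∈)  (here refl) = contradiction a<b (<-asym (All.lookup (sorted⇒head< s) a∈))
∈-pairs⁺ {x ∷ xs} s a<b (there a∈) (there b∈) =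
  ∈-++⁺ʳ (map (λ y → x ∷ y ∷ []) xs) (∈-pairs⁺ (sorted-tail s) a<b a∈ b∈)

∈-pairs-⊆ : ∀ E {g} → g ∈ pairs E → g ⊆ E
∈-pairs-⊆ (x ∷ xs) g∈ w∈ with ∈-++⁻ (map (λ y → x ∷ y ∷ []) xs) g∈
... | inj₂ g∈′ = there (∈-pairs-⊆ xs g∈′ w∈)
... | inj₁ g∈′ with ∈-map⁻ _ g∈′ | w∈
...   | y , y∈ , refl | here refl         = here refl
...   | y , y∈ , refl | there (here refl) = there y∈

-- Hypergraphs as lists of edges

Proper : List (List ℕ) → Set
Proper L = ∀ {E} → E ∈ L → Sorted E × E ≢ []

toHyp : (L : List (List ℕ)) → Proper L → Hypergraph
toHyp L ok = record
  { e        = length L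
  ; edge     = lookup L
  ; sorted   = λ i → proj₁ (ok (∈-lookup i))
  ; nonempty = λ i → proj₂ (ok (∈-lookup i))
  }

edges : Hypergraph → List (List ℕ)
edges H = tabulate (edge H)

∈-edges⁻ : ∀ H {E} → E ∈ edges H → ∃ λ i → edge H i ≡ E
∈-edges⁻ H E∈ with ∈-tabulate⁻ E∈
... | i , eq = i , sym eq

vertices : Hypergraph → List ℕ
vertices H = deduplicate _≟_ (concat (map (edge H) (allFin (e H))))

vertices-unique : ∀ H → Unique (vertices H)
vertices-unique H = deduplicate-! (concat (map (edge H) (allFin (e H))))

∈-vertices⁺ : ∀ H {v} → v ∈V H → v ∈ vertices H
∈-vertices⁺ H (i , v∈) =
  ∈-deduplicate⁺ _≟_ (∈-concat⁺′ v∈ (∈-map⁺ (edge H) (∈-allFin i)))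

vH-≤ : ∀ H (W : List ℕ) → (∀ i {v} → v ∈ edge H i → v ∈ W) → vH H ≤ length W
vH-≤ H W cover = unique-⊆-length (vertices-unique H) sub
  where
  sub : vertices H ⊆ W
  sub v∈ with ∈-concat⁻′ (map (edge H) (allFin (e H))) (∈-deduplicate⁻ _≟_ _ v∈)
  ... | E , v∈E , E∈ with ∈-map⁻ (edge H) E∈
  ...   | i , _ , refl = cover i v∈E

-- `W` stands in for the vertex set and may be larger; `vH` is only ever bounded through the length
-- of such a list.
Covers : List ℕ → List (List ℕ) → Set
Covers W L = ∀ {E} → E ∈ L → E ⊆ W

vH-toHyp-≤ : ∀ {L} (ok : Proper L) (W : List ℕ) → Covers W L → vH (toHyp L ok) ≤ length W
vH-toHyp-≤ ok W cover = vH-≤ (toHyp _ ok) W (λ i → cover (∈-lookup i))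

-- Edges are recorded by value, not by index, so that a copy can pass to another list by inclusion
-- or by replacing each edge. On lists without repetitions this agrees with `Embedding`.
record Copy (F : Hypergraph) (L : List (List ℕ)) : Set where
  field
    ψ     : ℕ → ℕ
    ψ-inc : ∀ u w → u ∈V F → w ∈V F → u < w → ψ u < ψ w
    t     : Fin (e F) → List ℕ
    t-inj : Injective _≡_ _≡_ t
    t∈    : ∀ i → t i ∈ L
    t-sup : ∀ i v → v ∈ edge F i → ψ v ∈ t i

copy-mono : ∀ {F L L′} → L ⊆ L′ → Copy F L → Copy F L′
copy-mono L⊆ c = record { Copy c ; t∈ = L⊆ ∘ Copy.t∈ c }

embedding⇒copy : ∀ {F L} {ok : Proper L} → Unique L → Embedding F (toHyp L ok) → Copy F L
embedding⇒copy {L = L} u emb = record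
  { ψ     = φ emb
  ; ψ-inc = φ-inc emb
  ; t     = lookup L ∘ f emb
  ; t-inj = f-inj emb ∘ lookup-injective u
  ; t∈    = λ i → ∈-lookup (f emb i)
  ; t-sup = incl emb
  }

copy⇒embedding : ∀ {F} H → Copy F (edges H) → Embedding F H
copy⇒embedding {F} H c = record
  { φ     = ψ
  ; φ-inc = ψ-inc
  ; f     = λ i → proj₁ (at i)
  ; f-inj = λ {i} {j} eq →
      t-inj (trans (sym (proj₂ (at i))) (trans (cong (edge H) eq) (proj₂ (at j))))
  ; incl  = λ i v v∈ → subst (ψ v ∈_) (sym (proj₂ (at i))) (t-sup i v v∈)
  }
  where
  open Copy c
  at : ∀ i → ∃ λ j → edge H j ≡ t i
  at i = ∈-edges⁻ H (t∈ i)

edge-pair : ∀ F → IsGraph F → ∀ i → ∃₂ λ a b → edge F i ≡ a ∷ b ∷ [] × a < b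
edge-pair F gr i with edge F i | gr i | sorted F i
... | a ∷ b ∷ [] | refl | a<b ∷ _ = a , b , refl , a<b

increasing⇒injective : ∀ F {ψ : ℕ → ℕ} →
  (∀ u w → u ∈V F → w ∈V F → u < w → ψ u < ψ w) →
  ∀ {u w} → u ∈V F → w ∈V F → ψ u ≡ ψ w → u ≡ w
increasing⇒injective F inc {u} {w} u∈ w∈ eq with <-cmp u w
... | tri< u<w _ _ = contradiction eq (<⇒≢ (inc u w u∈ w∈ u<w))
... | tri≈ _ u≡w _ = u≡w
... | tri> _ _ w<u = contradiction (sym eq) (<⇒≢ (inc w u w∈ u∈ w<u))

-- Large edges

-- Junk value 0 beyond the end of the list.
nth : List ℕ → ℕ → ℕ
nth []       _       = 0
nth (x ∷ xs) zero    = x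
nth (x ∷ xs) (suc k) = nth xs k

nth-∈ : ∀ E {k} → k < length E → nth E k ∈ E
nth-∈ (x ∷ xs) {zero}  _       = here refl
nth-∈ (x ∷ xs) {suc k} (s≤s k<) = there (nth-∈ xs k<)

nth-< : ∀ {E j k} → Sorted E → j < k → k < length E → nth E j < nth E k
nth-< {x ∷ xs} {zero}  {suc k} s _         (s≤s k<) = All.lookup (sorted⇒head< s) (nth-∈ xs k<)
nth-< {x ∷ xs} {suc j} {suc k} s (s≤s j<k) (s≤s k<) = nth-< (sorted-tail s) j<k k<

-- Send the vertex of `F` with k smaller vertices to the entry of `E` at position k, counting from
-- 0. This map is increasing, so each edge of `F` lands on a pair inside `E`.
clique-copy : ∀ F → IsSimpleGraph F → ∀ {E R} → Sorted E → vH F ≤ length E → pairs E ⊆ R → Copy F R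
clique-copy F (simple , gr) {E} {R} s p≤ pairs⊆ = record
  { ψ     = ψ
  ; ψ-inc = ψ-inc
  ; t     = map ψ ∘ edge F
  ; t-inj = t-inj
  ; t∈    = t∈
  ; t-sup = λ i v → ∈-map⁺ ψ
  }
  where
  below : ℕ → List ℕ
  below v = filter (_<? v) (vertices F)

  -- Counting `v` together with `below v` yields both strict inequalities for the rank: this list
  -- lies in `below w` when v < w, and always in `vertices F`.
  unique-below : ∀ v → Unique (v ∷ below v)
  unique-below v =
    All.tabulate (λ w∈ → ≢-sym (<⇒≢ (proj₂ (∈-filter⁻ (_<? v) {xs = vertices F} w∈))))
    ∷ filter⁺ (_<? v) (vertices-unique F)

  rank : ℕ → ℕ
  rank v = length (below v)

  rank-< : ∀ u w → u ∈V F → u < w → rank u < rank w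
  rank-< u w u∈ u<w = unique-⊆-length (unique-below u) λ where
    (here refl) → ∈-filter⁺ (_<? w) (∈-vertices⁺ F u∈) u<w
    (there z∈)  → let z∈V , z<u = ∈-filter⁻ (_<? u) {xs = vertices F} z∈ in
                  ∈-filter⁺ (_<? w) z∈V (<-trans z<u u<w)

  rank-bound : ∀ v → v ∈V F → rank v < length E
  rank-bound v v∈ = <-≤-trans (unique-⊆-length (unique-below v) λ where
    (here refl) → ∈-vertices⁺ F v∈
    (there z∈)  → proj₁ (∈-filter⁻ (_<? v) z∈)) p≤

  ψ : ℕ → ℕ
  ψ v = nth E (rank v)

  ψ-inc : ∀ u w → u ∈V F → w ∈V F → u < w → ψ u < ψ w
  ψ-inc u w u∈ w∈ u<w = nth-< s (rank-< u w u∈ u<w) (rank-bound w w∈)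

  ψ-inj : ∀ {u w} → u ∈V F → w ∈V F → ψ u ≡ ψ w → u ≡ w
  ψ-inj = increasing⇒injective F ψ-inc

  map-ψ-inj : ∀ xs ys → (∀ {v} → v ∈ xs → v ∈V F) → (∀ {v} → v ∈ ys → v ∈V F) →
    map ψ xs ≡ map ψ ys → xs ≡ ys
  map-ψ-inj []       []       _ _ _  = refl
  map-ψ-inj (x ∷ xs) (y ∷ ys) p q eq = cong₂ _∷_
    (ψ-inj (p (here refl)) (q (here refl)) (∷-injectiveˡ eq))
    (map-ψ-inj xs ys (p ∘ there) (q ∘ there) (∷-injectiveʳ eq))

  t-inj : Injective _≡_ _≡_ (map ψ ∘ edge F)
  t-inj {i} {j} eq = simple (map-ψ-inj _ _ (i ,_) (j ,_) eq)

  t∈ : ∀ i → map ψ (edge F i) ∈ R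
  t∈ i with edge F i in eq | edge-pair F gr i
  ... | _ | a , b , refl , a<b =
    pairs⊆ (∈-pairs⁺ s (ψ-inc a b a∈ b∈ a<b) (nth-∈ E (rank-bound a a∈)) (nth-∈ E (rank-bound b b∈)))
    where
    a∈ : a ∈V F
    a∈ = i , subst (a ∈_) (sym eq) (here refl)
    b∈ : b ∈V F
    b∈ = i , subst (b ∈_) (sym eq) (there (here refl))

_∈pairs_ : List ℕ → List ℕ → Set
g ∈pairs E = g ∈ pairs E

partner : ∀ {R L r} → Pointwise _∈pairs_ R L → r ∈ R → ∃ λ E → E ∈ L × r ∈pairs E
partner (r∈ ∷ _)  (here refl) = _ , here refl , r∈
partner (_  ∷ pw) (there p) with partner pw p
... | E , E∈ , r∈ = E , there E∈ , r∈

-- Since `L` has no repetitions, equal partners occupy the same position, and `r` and `s` are then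
-- the entry of `R` at that position.
partner-injective : ∀ {R L r s} → Unique L → (pw : Pointwise _∈pairs_ R L) (p : r ∈ R) (q : s ∈ R) →
  proj₁ (partner pw p) ≡ proj₁ (partner pw q) → r ≡ s
partner-injective _        (_ ∷ _)  (here refl) (here refl) _  = refl
partner-injective (E∉ ∷ _) (_ ∷ pw) (here refl) (there q)   eq =
  contradiction eq (All.lookup E∉ (proj₁ (proj₂ (partner pw q))))
partner-injective (E∉ ∷ _) (_ ∷ pw) (there p)   (here refl) eq =
  contradiction (sym eq) (All.lookup E∉ (proj₁ (proj₂ (partner pw p))))
partner-injective (_ ∷ u)  (_ ∷ pw) (there p)   (there q)   eq = partner-injective u pw p q eq

-- Enlarging each pair to its partner keeps the images of the vertices inside and, by
-- `partner-injective`, keeps the edges distinct.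
copy-partner : ∀ {F R L} → Unique L → Pointwise _∈pairs_ R L → Copy F R → Copy F L
copy-partner u pw c = record
  { ψ     = ψ
  ; ψ-inc = ψ-inc
  ; t     = λ i → proj₁ (at i)
  ; t-inj = λ {i} {j} eq → t-inj (partner-injective u pw (t∈ i) (t∈ j) eq)
  ; t∈    = λ i → proj₁ (proj₂ (at i))
  ; t-sup = λ i v v∈ → ∈-pairs-⊆ (proj₁ (at i)) (proj₂ (proj₂ (at i))) (t-sup i v v∈)
  }
  where
  open Copy c
  at = λ i → partner pw (t∈ i)

-- Greedy choice, the tail first. If all pairs of `E` are already in `R`, they contain a copy of `F`
-- by `clique-copy`, and `copy-partner` turns it into a copy in `L`.
distinct-pairs : ∀ F → IsSimpleGraph F → ∀ L → Unique L →
  (∀ {E} → E ∈ L → Sorted E × vH F ≤ length E) → ¬ Copy F L →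
  ∃ λ R → Unique R × Pointwise _∈pairs_ R L
distinct-pairs F sg []      _        _  _    = [] , [] , []
distinct-pairs F sg (E ∷ L) (E∉ ∷ u) ok free
  with distinct-pairs F sg L u (ok ∘ there) (free ∘ copy-mono there)
... | R , uR , pw with any? (λ g → ¬? (g ∈L? R)) (pairs E)
...   | yes new = let r , r∈ , r∉ = find new in
                  r ∷ R , All.tabulate (λ { g∈ refl → r∉ g∈ }) ∷ uR , r∈ ∷ pw
...   | no taken = contradiction
        (copy-mono there (copy-partner u pw
          (clique-copy F sg (proj₁ (ok (here refl))) (proj₂ (ok (here refl)))
            (λ {g} g∈ → decidable-stable (g ∈L? R) (All.lookup (¬Any⇒All¬ _ taken) g∈)))))
        free

∈pairs-proper : ∀ {g E} → Sorted E → g ∈pairs E → Sorted g × g ≢ []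
∈pairs-proper s g∈ with ∈-pairs⁻ _ s g∈
... | a , b , refl , a<b , _ = a<b ∷ [-] , λ ()

∈pairs-length : ∀ {g E} → Sorted E → g ∈pairs E → length g ≡ 2
∈pairs-length s g∈ with ∈-pairs⁻ _ s g∈
... | a , b , refl , _ = refl

large-edges-bound : ∀ F → IsSimpleGraph F → ∀ {n g} → IsGex (Singleton F) n g →
  ∀ L → Unique L → (∀ {E} → E ∈ L → Sorted E × vH F ≤ length E) → ¬ Copy F L →
  ∀ V → length V ≤ n → Covers V L → length L ≤ g
large-edges-bound F sg {n} {g} (_ , max) L u ok free V |V|≤n cover
  with distinct-pairs F sg L u ok free
... | R , uR , pw = ≤-trans (≤-reflexive (sym (Pointwise-length pw))) (max (toHyp R proper) adm)
  where
  proper : Proper R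
  proper r∈ = let _ , E∈ , r∈E = partner pw r∈ in ∈pairs-proper (proj₁ (ok E∈)) r∈E
  coverR : Covers V R
  coverR r∈ = let E , E∈ , r∈E = partner pw r∈ in cover E∈ ∘ ∈-pairs-⊆ E r∈E
  adm : GexAdmissible (Singleton F) n (toHyp R proper)
  adm = ( lookup-injective uR
        , λ i → let _ , E∈ , r∈E = partner pw (∈-lookup i) in ∈pairs-length (proj₁ (ok E∈)) r∈E )
      , ≤-trans (vH-toHyp-≤ proper V coverR) |V|≤n
      , λ { _ refl emb → free (copy-partner u pw (embedding⇒copy {ok = proper} uR emb)) }

-- Small edges

-- A pair may lie in several edges; deduplication makes the graph simple.
pairGraph : List (List ℕ) → List (List ℕ)
pairGraph L = deduplicate _≟L_ (concatMap pairs L)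

pairGraph-unique : ∀ L → Unique (pairGraph L)
pairGraph-unique L = deduplicateL-! (concatMap pairs L)

-- The position found here later serves as the colour of the pair.
home : ∀ L {g} → g ∈ pairGraph L → Any (g ∈pairs_) L
home L g∈ = ∈-concatMap⁻ pairs (∈-deduplicate⁻ _≟L_ (concatMap pairs L) g∈)

∈-pairGraph⁺ : ∀ {L E g} → E ∈ L → g ∈pairs E → g ∈ pairGraph L
∈-pairGraph⁺ E∈ g∈ = ∈-deduplicate⁺ _≟L_ (∈-concatMap⁺ pairs (lose E∈ g∈))

pairGraph-proper : ∀ {L} → Proper L → Proper (pairGraph L)
pairGraph-proper {L} ok g∈ = let _ , E∈ , g∈E = find (home L g∈) in ∈pairs-proper (proj₁ (ok E∈)) g∈E

pairGraph-graph : ∀ {L} → Proper L → ∀ {g} → g ∈ pairGraph L → length g ≡ 2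
pairGraph-graph {L} ok g∈ = let _ , E∈ , g∈E = find (home L g∈) in ∈pairs-length (proj₁ (ok E∈)) g∈E

pairGraph-covers : ∀ {V L} → Covers V L → Covers V (pairGraph L)
pairGraph-covers {L = L} cover g∈ = let E , E∈ , g∈E = find (home L g∈) in cover E∈ ∘ ∈-pairs-⊆ E g∈E

-- Colour each pair by an edge containing it: an edge of at most p elements
-- gives its colour to at most p C 2 pairs, so a rainbow copy of F exists,
-- and replacing its pairs by their colours gives a copy of F in L.
blow-up⇒copy : ∀ {F G′ L p} (ok : Proper L) → Unique L → (∀ {E} → E ∈ L → length E ≤ p) →
  IsBlowUp (p C 2) F G′ → Embedding G′ (toHyp (pairGraph L) (pairGraph-proper ok)) → Copy F L
blow-up⇒copy {F} {G′} {L} {p} ok u small ((simple , _) , rainbow) emb = record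
  { ψ     = φ emb ∘ φ emb′
  ; ψ-inc = λ v w v∈ w∈ v<w →
      φ-inc emb _ _ (embed-vertex v∈) (embed-vertex w∈) (φ-inc emb′ v w v∈ w∈ v<w)
  ; t     = λ i → lookup L (colour (f emb′ i))
  ; t-inj = λ eq → χ-inj (cong toℕ (lookup-injective u eq))
  ; t∈    = λ i → ∈-lookup (colour (f emb′ i))
  ; t-sup = λ i v v∈ → ∈-pairs-⊆ (lookup L (colour (f emb′ i))) (in-colour (f emb′ i))
                         (incl emb (f emb′ i) (φ emb′ v) (incl emb′ i v v∈))
  }
  where
  G = pairGraph L

  pair : Fin (e G′) → List ℕ
  pair i = lookup G (f emb i)

  colour : Fin (e G′) → Fin (length L)
  colour i = index (home L (∈-lookup {xs = G} (f emb i)))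

  in-colour : ∀ i → pair i ∈pairs lookup L (colour i)
  in-colour i = lookup-index (home L (∈-lookup {xs = G} (f emb i)))

  χ : Fin (e G′) → ℕ
  χ = toℕ ∘ colour

  class-bound : ∀ c I → Unique I → (∀ {i} → i ∈ I → χ i ≡ c) → length I ≤ p C 2
  class-bound c []         _  _  = z≤n
  -- An arbitrary `c` need not be an index of `L`. The member `i₀` supplies one, and all pairs of
  -- the class lie in the edge at that index.
  class-bound c I@(i₀ ∷ _) uI eq = begin
    length I                              ≡⟨ length-map pair I ⟨
    length (map pair I)                   ≤⟨ unique-⊆-length (Uniq.map⁺ pair-inj uI) sub ⟩
    length (pairs (lookup L (colour i₀))) ≡⟨ length-pairs (lookup L (colour i₀)) ⟩
    length (lookup L (colour i₀)) C 2     ≤⟨ C2-mono (small (∈-lookup (colour i₀))) ⟩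
    p C 2                                 ∎
    where
    open ≤-Reasoning
    pair-inj : ∀ {i j} → pair i ≡ pair j → i ≡ j
    pair-inj = f-inj emb ∘ lookup-injective (pairGraph-unique L)
    sub : map pair I ⊆ pairs (lookup L (colour i₀))
    sub g∈ with ∈-map⁻ pair g∈
    ... | i , i∈ , refl = subst (λ c → pair i ∈pairs lookup L c)
      (toℕ-injective (trans (eq i∈) (sym (eq (here refl))))) (in-colour i)

  bounded : ∀ c → colourCount G′ χ c ≤ p C 2
  bounded c = class-bound c _ (filter⁺ (λ i → χ i ≟ c) (allFin⁺ (e G′)))
    (λ i∈ → proj₂ (∈-filter⁻ (λ i → χ i ≟ c) {xs = allFin (e G′)} i∈))

  emb′ : Embedding F G′
  emb′ = proj₁ (rainbow χ bounded)

  χ-inj : Injective _≡_ _≡_ (χ ∘ f emb′)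
  χ-inj = proj₂ (rainbow χ bounded)

  embed-vertex : ∀ {v} → v ∈V F → φ emb′ v ∈V G′
  embed-vertex (i , v∈) = f emb′ i , incl emb′ i _ v∈

-- Degrees and neighbourhoods

star : List (List ℕ) → ℕ → List (List ℕ)
star L v = filter (v ∈?_) L

degree : List (List ℕ) → ℕ → ℕ
degree G v = length (star G v)

-- Handshake argument: if all degrees were at least 2d, counting incidences by vertices and by
-- edges, with at most 2 per edge, would give 2d|V| ≤ 2|G|.
low-degree-vertex : ∀ {V G d} → Unique V → (∀ {g} → g ∈ G → length g ≡ 2) →
  length G < length V * d → ∃ λ v → v ∈ V × degree G v < 2 * d
low-degree-vertex {V} {G} {d} uV gr sparse with any? (λ v → degree G v <? 2 * d) V
... | yes low = find low
... | no high = contradiction sparse (≤⇒≯ (*-cancelʳ-≤ (length V * d) (length G) 2 (begin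
  length V * d * 2                                 ≡⟨ *-assoc (length V) d 2 ⟩
  length V * (d * 2)                               ≡⟨ cong (length V *_) (*-comm d 2) ⟩
  length V * (2 * d)                               ≤⟨ sum-map-≥ (degree G) (2 * d) V
                                                          (All.map ≮⇒≥ (¬Any⇒All¬ V high)) ⟩
  sum (map (degree G) V)                           ≡⟨ double-count _∈?_ V G ⟩
  sum (map (λ g → length (filter (_∈? g) V)) G)    ≤⟨ sum-map-≤ _ 2 G two ⟩
  length G * 2                                     ∎)))
  where
  open ≤-Reasoning
  two : ∀ {g} → g ∈ G → length (filter (_∈? g) V) ≤ 2
  two {g} g∈ = ≤-trans
    (unique-⊆-length (filter⁺ (_∈? g) uV) (λ v∈ → proj₂ (∈-filter⁻ (_∈? g) {xs = V} v∈)))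
    (≤-reflexive (gr g∈))

-- The value on lists other than pairs through v is irrelevant.
other : ℕ → List ℕ → ℕ
other v (a ∷ b ∷ _) with v ≟ a
... | yes _ = b
... | no _  = a
other v _ = v

other-left : ∀ v w → other v (v ∷ w ∷ []) ≡ w
other-left v w with v ≟ v
... | yes _  = refl
... | no v≢v = contradiction refl v≢v

other-right : ∀ {v w} → v ≢ w → other v (w ∷ v ∷ []) ≡ w
other-right {v} {w} v≢w with v ≟ w
... | yes v≡w = contradiction v≡w v≢w
... | no _    = refl

neighbourhood : List (List ℕ) → ℕ → List ℕ
neighbourhood G v = v ∷ map (other v) (star G v)

-- A vertex `w` ≠ `v` of an edge through `v` forms with `v` a pair of the pair graph, whose other
-- end is `w`. The order of `v` and `w` decides how that pair is written.
star-covered : ∀ {L} → Proper L → ∀ v → Covers (neighbourhood (pairGraph L) v) (star L v)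
star-covered {L} ok v E∈ {w} w∈E with ∈-filter⁻ (v ∈?_) {xs = L} E∈
... | E∈L , v∈E with <-cmp v w
...   | tri≈ _ refl _ = here refl
...   | tri< v<w _ _  = there (subst (_∈ _) (other-left v w) (∈-map⁺ (other v)
          (∈-filter⁺ (v ∈?_) (∈-pairGraph⁺ E∈L (∈-pairs⁺ (proj₁ (ok E∈L)) v<w v∈E w∈E)) (here refl))))
...   | tri> _ v≢w w<v = there (subst (_∈ _) (other-right v≢w) (∈-map⁺ (other v)
          (∈-filter⁺ (v ∈?_) (∈-pairGraph⁺ E∈L (∈-pairs⁺ (proj₁ (ok E∈L)) w<v w∈E v∈E)) (there (here refl)))))

exe-bound : ∀ {F k x} → IsExe F k x → ∀ {L} → Proper L → Unique L → ¬ Copy F L →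
  ∀ W → Covers W L → length W ≤ k → length L ≤ x
exe-bound (_ , max) {L} ok u free W cover W≤ = max (toHyp L ok)
  (lookup-injective u , ≤-trans (vH-toHyp-≤ ok W cover) W≤ , free ∘ embedding⇒copy {ok = ok} u)

-- Bounding the small edges by deleting vertices

module SmallEdges
  (F : Hypergraph)
  (B : Hypergraph → Set) (B⊆ : ∀ G′ → B G′ → G′ ∈B[ vH F C 2 , F ])
  (f : ℕ → ℕ) (f-mono : Nondecreasing f)
  (sparse : ∀ n → 1 ≤ n → ∀ G → GexAdmissible B n G → eH G < n * f n)
  where

  Small : List (List ℕ) → Set
  Small L = ∀ {E} → E ∈ L → length E ≤ vH F

  -- A member of `B` in the pair graph would be a blow-up of `F`, and `blow-up⇒copy` would put `F`
  -- into `L`. The hypothesis is taken at `length V`, so the density bound follows `V` as it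
  -- shrinks.
  pairGraph-sparse : ∀ {L} → Proper L → Unique L → Small L → ¬ Copy F L →
    ∀ V → 1 ≤ length V → Covers V L → length (pairGraph L) < length V * f (length V)
  pairGraph-sparse {L} ok u small free V 1≤ cover =
    sparse (length V) 1≤ (toHyp (pairGraph L) (pairGraph-proper ok))
      ( (lookup-injective (pairGraph-unique L) , λ i → pairGraph-graph ok (∈-lookup i))
      , vH-toHyp-≤ (pairGraph-proper ok) V (pairGraph-covers cover)
      , λ G′ G′∈B emb → free (blow-up⇒copy ok u small (B⊆ G′ G′∈B) emb))

  -- Induction on `m`, which bounds the number of remaining vertices. The ambient `n` stays fixed:
  -- monotonicity of `f` lets the same `x` bound the star at every stage.
  small-edges-bound : ∀ {n x} → IsExe F (2 * f n + 1) x →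
    ∀ m → m ≤ n → ∀ L → Proper L → Unique L → Small L → ¬ Copy F L →
    ∀ V → Unique V → length V ≤ m → Covers V L → length L ≤ m * x
  small-edges-bound _ m _ [] _ _ _ _ _ _ _ _ = z≤n
  small-edges-bound _ m _ ([] ∷ _) ok _ _ _ _ _ _ _ = contradiction refl (proj₂ (ok (here refl)))
  small-edges-bound _ zero _ ((_ ∷ _) ∷ _) _ _ _ _ V@[] _ _ cover = contradiction (cover (here refl) (here refl)) λ ()
  small-edges-bound {n} {x} exe (suc m) m<n L@((a ∷ _) ∷ _) ok u small free V uV |V|≤ cover
    -- The element `a` of the first edge shows that `V` is nonempty, as `pairGraph-sparse` requires.
    with low-degree-vertex {V} {pairGraph L} {f n} uV (pairGraph-graph ok)
           (<-≤-trans (pairGraph-sparse ok u small free V (∈-length (cover (here refl) (here refl))) cover)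
             (*-monoʳ-≤ (length V) (f-mono _ _ (≤-trans |V|≤ m<n))))
  ... | v , v∈V , low = begin
    length L                                            ≡⟨ length-filter-¬ (v ∈?_) L ⟩
    length (star L v) + length rest                     ≤⟨ +-mono-≤ through avoiding ⟩
    x + m * x                                           ∎
    where
    open ≤-Reasoning
    rest = filter (¬? ∘ (v ∈?_)) L
    V′ = filter (¬? ∘ (v ≟_)) V

    star⊆ : star L v ⊆ L
    star⊆ E∈ = proj₁ (∈-filter⁻ (v ∈?_) E∈)

    rest⊆ : rest ⊆ L
    rest⊆ E∈ = proj₁ (∈-filter⁻ (¬? ∘ (v ∈?_)) E∈)

    through : length (star L v) ≤ x
    through = exe-bound exe (ok ∘ star⊆) (filter⁺ (v ∈?_) u) (free ∘ copy-mono star⊆)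
      (neighbourhood (pairGraph L) v) (star-covered ok v) (begin
        suc (length (map (other v) (star (pairGraph L) v))) ≡⟨ cong suc (length-map (other v) (star (pairGraph L) v)) ⟩
        -- The strict inequality `low` makes room for `v` itself.
        suc (degree (pairGraph L) v)                        ≤⟨ low ⟩
        2 * f n                                             ≤⟨ m≤m+n (2 * f n) 1 ⟩
        2 * f n + 1                                         ∎)

    cover′ : Covers V′ rest
    cover′ E∈ w∈ with ∈-filter⁻ (¬? ∘ (v ∈?_)) {xs = L} E∈
    ... | E∈L , v∉E = ∈-filter⁺ (¬? ∘ (v ≟_)) (cover E∈L w∈) λ { refl → v∉E w∈ }

    V′≤ : length V′ ≤ m
    V′≤ = s≤s⁻¹ (≤-trans (filter-notAll (¬? ∘ (v ≟_)) V (lose v∈V (λ v≢v → v≢v refl))) |V|≤)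

    avoiding : length rest ≤ m * x
    avoiding = small-edges-bound exe m (<⇒≤ m<n) rest (ok ∘ rest⊆) (filter⁺ (¬? ∘ (v ∈?_)) u)
      (small ∘ rest⊆) (free ∘ copy-mono rest⊆) V′ (filter⁺ (¬? ∘ (v ≟_)) uV) V′≤ cover′

  -- The graph without edges is admissible, because every member of `B` has an edge in which to find
  -- `F`; hence 0 < n f(n).
  f-positive : 1 < eH F → ∀ n → 1 ≤ n → 1 ≤ f n
  f-positive q>1 n 1≤n = *-cancelˡ-< n 0 (f n) (≤-<-trans (≤-reflexive (*-zeroʳ n)) (≤-<-trans z≤n
      (subst (λ k → 0 < k * f k) (length-upTo n)
        (pairGraph-sparse {[]} (λ ()) [] (λ ()) empty-free (upTo n)
          (≤-trans 1≤n (≤-reflexive (sym (length-upTo n)))) (λ ())))))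
    where
    empty-free : ¬ Copy F []
    empty-free c with Copy.t∈ c (Fin.fromℕ< (<-trans z<s q>1))
    ... | ()

-- Lower bounds for gex and ex_e

gex-bound : ∀ {F n g} → IsGex (Singleton F) n g → ∀ {L} (ok : Proper L) → Unique L →
  (∀ {E} → E ∈ L → length E ≡ 2) → Covers (upTo n) L → ¬ Copy F L → length L ≤ g
gex-bound {n = n} (_ , max) {L} ok u gr cover free = max (toHyp L ok)
  ( (lookup-injective u , λ i → gr (∈-lookup i))
  , ≤-trans (vH-toHyp-≤ ok (upTo n) cover) (≤-reflexive (length-upTo n))
  , λ { _ refl → free ∘ embedding⇒copy {ok = ok} u })

-- The stars on 0, ..., n centred at the first and at the last vertex, with n edges each.
leftStar rightStar : ℕ → List (List ℕ)
leftStar  n = map (λ k → 0 ∷ suc k ∷ []) (upTo n)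
rightStar n = map (λ k → k ∷ n ∷ []) (upTo n)

∈-leftStar : ∀ {n E} → E ∈ leftStar n → ∃ λ k → E ≡ 0 ∷ suc k ∷ [] × k < n
∈-leftStar E∈ with ∈-map⁻ _ E∈
... | k , k∈ , refl = k , refl , ∈-upTo⁻ k∈

∈-rightStar : ∀ {n E} → E ∈ rightStar n → ∃ λ k → E ≡ k ∷ n ∷ [] × k < n
∈-rightStar E∈ with ∈-map⁻ _ E∈
... | k , k∈ , refl = k , refl , ∈-upTo⁻ k∈

increasing-pair : ∀ {a b c d : ℕ} → a < b → a ∈ (c ∷ d ∷ []) → b ∈ (c ∷ d ∷ []) → c < d → a ≡ c × b ≡ d
increasing-pair a<b (here refl)         (there (here refl)) _   = refl , refl
increasing-pair a<b (here refl)         (here refl)         _   = contradiction a<b (<-irrefl refl)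
increasing-pair a<b (there (here refl)) (there (here refl)) _   = contradiction a<b (<-irrefl refl)
increasing-pair a<b (there (here refl)) (here refl)         c<d = contradiction a<b (<-asym c<d)

copy-edge : ∀ {F L} → IsGraph F → (c : Copy F L) → ∀ i → ∃₂ λ a b →
  edge F i ≡ a ∷ b ∷ [] × a ∈V F × b ∈V F × Copy.ψ c a < Copy.ψ c b ×
  Copy.ψ c a ∈ Copy.t c i × Copy.ψ c b ∈ Copy.t c i
copy-edge {F} gr c i with edge-pair F gr i
... | a , b , eq , a<b =
  a , b , eq , (i , a∈) , (i , b∈) , Copy.ψ-inc c a b (i , a∈) (i , b∈) a<b ,
  Copy.t-sup c i a a∈ , Copy.t-sup c i b b∈
  where
  a∈ = subst (a ∈_) (sym eq) (here refl)
  b∈ = subst (b ∈_) (sym eq) (there (here refl))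

-- An increasing map sends the left end of every edge of `F` to the centre 0; as it is injective,
-- all these left ends agree.
leftStar-copy : ∀ {F n} → IsGraph F → Copy F (leftStar n) → ∀ i j →
  ∃ λ a → ∃₂ λ b d → edge F i ≡ a ∷ b ∷ [] × edge F j ≡ a ∷ d ∷ []
leftStar-copy {F} gr c i j
  with copy-edge gr c i | ∈-leftStar (Copy.t∈ c i) | copy-edge gr c j | ∈-leftStar (Copy.t∈ c j)
... | a , b , eq , a∈ , _ , lt , ψa∈ , ψb∈ | _ , ti , _ | a′ , b′ , eq′ , a′∈ , _ , lt′ , ψa′∈ , ψb′∈ | _ , tj , _
  with increasing-pair lt (subst (_ ∈_) ti ψa∈) (subst (_ ∈_) ti ψb∈) z<s
     | increasing-pair lt′ (subst (_ ∈_) tj ψa′∈) (subst (_ ∈_) tj ψb′∈) z<s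
... | ψa≡0 , _ | ψa′≡0 , _
  with increasing⇒injective F (Copy.ψ-inc c) a∈ a′∈ (trans ψa≡0 (sym ψa′≡0))
... | refl = a , b , b′ , eq , eq′

rightStar-copy : ∀ {F n} → IsGraph F → Copy F (rightStar n) → ∀ i j →
  ∃ λ b → ∃₂ λ a d → edge F i ≡ a ∷ b ∷ [] × edge F j ≡ d ∷ b ∷ []
rightStar-copy {F} gr c i j
  with copy-edge gr c i | ∈-rightStar (Copy.t∈ c i) | copy-edge gr c j | ∈-rightStar (Copy.t∈ c j)
... | a , b , eq , _ , b∈ , lt , ψa∈ , ψb∈ | _ , ti , k<n | a′ , b′ , eq′ , _ , b′∈ , lt′ , ψa′∈ , ψb′∈ | _ , tj , k′<n
  with increasing-pair lt (subst (_ ∈_) ti ψa∈) (subst (_ ∈_) ti ψb∈) k<n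
     | increasing-pair lt′ (subst (_ ∈_) tj ψa′∈) (subst (_ ∈_) tj ψb′∈) k′<n
... | _ , ψb≡n | _ , ψb′≡n
  with increasing⇒injective F (Copy.ψ-inc c) b∈ b′∈ (trans ψb≡n (sym ψb′≡n))
... | refl = b , a , a′ , eq , eq′

-- Two edges sharing both their left and their right endpoints coincide.
not-both-stars : ∀ {F n} → IsSimpleGraph F → 1 < eH F → Copy F (leftStar n) → ¬ Copy F (rightStar n)
not-both-stars {F} (simple , gr) q>1 l r
  -- `i` and `j` are the edges 0 and 1 of `F`. Simplicity will identify them, and the saved
  -- equations turn this into 0 = 1.
  with Fin.fromℕ< (<-trans z<s q>1) in eq₀ | Fin.fromℕ< q>1 in eq₁
... | i | j with leftStar-copy gr l i j | rightStar-copy gr r i j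
...   | _ , _ , _ , p , q | _ , _ , _ , p′ , q′
  with trans (sym p) p′ | trans (sym q) q′
...   | refl | refl = 0≢1+n (begin
  0                                  ≡⟨ toℕ-fromℕ< (<-trans z<s q>1) ⟨
  toℕ (Fin.fromℕ< (<-trans z<s q>1)) ≡⟨ cong toℕ (trans eq₀ (trans (simple (trans p (sym q))) (sym eq₁))) ⟩
  toℕ (Fin.fromℕ< q>1)               ≡⟨ toℕ-fromℕ< q>1 ⟩
  1                                  ∎)
  where open ≡-Reasoning

-- Arguing by contradiction avoids deciding which star is free of `F`: if g < n, the left star must
-- contain a copy, so the right star contains none and its n edges give n ≤ g.
gex-≥ : ∀ {F n g} → IsSimpleGraph F → 1 < eH F → IsGex (Singleton F) (suc n) g → n ≤ g
gex-≥ {F} {n} {g} sg q>1 gex = decidable-stable (n ≤? g) λ n≰g →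
  n≰g (subst (_≤ g) (trans (length-map _ (upTo n)) (length-upTo n))
    (gex-bound gex left-proper (Uniq.map⁺ (suc-injective ∘ ∷-injectiveˡ ∘ ∷-injectiveʳ) (upTo⁺ n))
      left-pair left-cover λ l →
  n≰g (subst (_≤ g) (trans (length-map _ (upTo n)) (length-upTo n))
    (gex-bound gex right-proper (Uniq.map⁺ ∷-injectiveˡ (upTo⁺ n))
      right-pair right-cover (not-both-stars sg q>1 l)))))
  where
  left-proper : Proper (leftStar n)
  left-proper E∈ with ∈-leftStar E∈
  ... | k , refl , _ = z<s ∷ [-] , λ ()

  left-pair : ∀ {E} → E ∈ leftStar n → length E ≡ 2
  left-pair E∈ with ∈-leftStar E∈
  ... | k , refl , _ = refl

  left-cover : Covers (upTo (suc n)) (leftStar n)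
  left-cover E∈ w∈ with ∈-leftStar E∈ | w∈
  ... | k , refl , k<n | here refl         = ∈-upTo⁺ z<s
  ... | k , refl , k<n | there (here refl) = ∈-upTo⁺ (s<s k<n)

  right-proper : Proper (rightStar n)
  right-proper E∈ with ∈-rightStar E∈
  ... | k , refl , k<n = k<n ∷ [-] , λ ()

  right-pair : ∀ {E} → E ∈ rightStar n → length E ≡ 2
  right-pair E∈ with ∈-rightStar E∈
  ... | k , refl , _ = refl

  right-cover : Covers (upTo (suc n)) (rightStar n)
  right-cover E∈ w∈ with ∈-rightStar E∈ | w∈
  ... | k , refl , k<n | here refl         = ∈-upTo⁺ (<-trans k<n (n<1+n n))
  ... | k , refl , k<n | there (here refl) = ∈-upTo⁺ (n<1+n n)

-- The `k` singletons are free of `F`, since an edge of `F` needs two distinct images in one edge.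
exe-≥ : ∀ {F k x} → IsGraph F → 0 < eH F → IsExe F k x → k ≤ x
exe-≥ {F} {k} {x} gr q>0 exe = subst (_≤ x) (trans (length-map [_] (upTo k)) (length-upTo k))
  (exe-bound exe proper (Uniq.map⁺ ∷-injectiveˡ (upTo⁺ k)) free (upTo k) cover (≤-reflexive (length-upTo k)))
  where
  singletons = map [_] (upTo k)

  proper : Proper singletons
  proper E∈ with ∈-map⁻ [_] E∈
  ... | v , _ , refl = [-] , λ ()

  cover : Covers (upTo k) singletons
  cover E∈ w∈ with ∈-map⁻ [_] E∈ | w∈
  ... | v , v∈ , refl | here refl = v∈

  free : ¬ Copy F singletons
  free c with copy-edge gr c (Fin.fromℕ< q>0) | ∈-map⁻ [_] (Copy.t∈ c (Fin.fromℕ< q>0))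
  ... | _ , _ , _ , _ , _ , lt , ψa∈ , ψb∈ | _ , _ , eq
    with subst (_ ∈_) eq ψa∈ | subst (_ ∈_) eq ψb∈
  ... | here p | here q = contradiction (trans p (sym q)) (<⇒≢ lt)

-- Combining the bounds

final-estimate : ∀ {n q g x} → n ≤ suc g → 2 ≤ q → 2 ≤ g → 3 ≤ x → n * x + g < q * g * x
-- Put g = 2 + a and x = 3 + b. The gap between 2gx and (g + 1)x + g is (g - 1)(x - 1) - 1 = 1 + 2a
-- + b + ab, which is positive.
final-estimate {n} {q} {suc (suc a)} {suc (suc (suc b))} n≤ 2≤q _ _ = begin-strict
  n * (3 + b) + (2 + a)                           ≤⟨ +-monoˡ-≤ (2 + a) (*-monoˡ-≤ (3 + b) n≤) ⟩
  (3 + a) * (3 + b) + (2 + a)                     <⟨ m<m+n _ z<s ⟩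
  (3 + a) * (3 + b) + (2 + a) + suc (2 * a + b + a * b) ≡⟨ identity a b ⟩
  2 * (2 + a) * (3 + b)                           ≤⟨ *-monoˡ-≤ (3 + b) (*-monoˡ-≤ (2 + a) 2≤q) ⟩
  q * (2 + a) * (3 + b)                           ∎
  where
  open ≤-Reasoning
  identity : ∀ a b → (3 + a) * (3 + b) + (2 + a) + (1 + (2 * a + b + a * b)) ≡ 2 * (2 + a) * (3 + b)
  identity = solve-∀
final-estimate {g = suc (suc _)} {suc zero}       _ _ _ (s≤s ())
final-estimate {g = suc (suc _)} {suc (suc zero)} _ _ _ (s≤s (s≤s ()))
final-estimate {g = suc zero} _ _ (s≤s ()) _

theorem2 : (F : Hypergraph) → IsSimpleGraph F → 1 < eH F →
    (B : Hypergraph → Set) → (∀ G′ → B G′ → G′ ∈B[ vH F C 2 , F ]) →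
    (f : ℕ → ℕ) → Nondecreasing f →
    (∀ n → 1 ≤ n → ∀ G → GexAdmissible B n G → eH G < n * f n) →
    ∀ n → 3 ≤ n →
    ∀ g x → IsGex (Singleton F) n g → IsExe F (2 * f n + 1) x →
    ∀ H → ExAdmissible F n H → eH H < eH F * g * x
theorem2 F sg q>1 B B⊆ f f-mono sparse n@(suc n′) (s≤s 2≤n′) g x gex exe H (simple , v≤n , free) =
  begin-strict
    eH H                                ≡⟨ length-tabulate (edge H) ⟨
    length L                            ≡⟨ length-filter-¬ small? L ⟩
    length smalls + length larges       ≤⟨ +-mono-≤ small-bound large-bound ⟩
    -- The hypothesis 3 ≤ n gives g ≥ n - 1 ≥ 2.
    n * x + g                           <⟨ final-estimate (s≤s n′≤g) q>1 (≤-trans 2≤n′ n′≤g) 3≤x ⟩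
    eH F * g * x                        ∎
  where
  open ≤-Reasoning
  open SmallEdges F B B⊆ f f-mono sparse

  L = edges H
  V = vertices H

  small? : Decidable (λ E → length E ≤ vH F)
  small? E = length E ≤? vH F

  smalls = filter small? L
  larges = filter (¬? ∘ small?) L

  smalls⊆ : smalls ⊆ L
  smalls⊆ E∈ = proj₁ (∈-filter⁻ small? E∈)

  larges⊆ : larges ⊆ L
  larges⊆ E∈ = proj₁ (∈-filter⁻ (¬? ∘ small?) E∈)

  uL : Unique L
  uL = tabulate⁺ simple

  proper : Proper L
  proper E∈ with ∈-edges⁻ H E∈
  ... | i , refl = sorted H i , nonempty H i

  cover : Covers V L
  cover E∈ w∈ with ∈-edges⁻ H E∈
  ... | i , refl = ∈-vertices⁺ H (i , w∈)

  no-copy : ∀ {K} → K ⊆ L → ¬ Copy F K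
  no-copy K⊆ = free ∘ copy⇒embedding H ∘ copy-mono K⊆

  small-bound : length smalls ≤ n * x
  small-bound = small-edges-bound exe n ≤-refl smalls (proper ∘ smalls⊆) (filter⁺ small? uL)
    (λ E∈ → proj₂ (∈-filter⁻ small? {xs = L} E∈)) (no-copy smalls⊆) V (vertices-unique H) v≤n (cover ∘ smalls⊆)

  large-bound : length larges ≤ g
  large-bound = large-edges-bound F sg gex larges (filter⁺ (¬? ∘ small?) uL)
    (λ E∈ → proj₁ (proper (larges⊆ E∈)) , <⇒≤ (≰⇒> (proj₂ (∈-filter⁻ (¬? ∘ small?) {xs = L} E∈))))
    (no-copy larges⊆) V v≤n (cover ∘ larges⊆)

  n′≤g : n′ ≤ g
  n′≤g = gex-≥ sg q>1 gex

  3≤x : 3 ≤ x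
  -- As f(n) ≥ 1, there are 2 f(n) + 1 ≥ 3 singletons to count.
  3≤x = ≤-trans (+-monoˡ-≤ 1 (*-monoʳ-≤ 2 (f-positive q>1 n (s≤s z≤n))))
    (exe-≥ (proj₂ sg) (<-trans z<s q>1) exe)
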